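{- Let $n \ge 2$ and let $(\mathcal{F},\mathcal{G})$ be a cross-Sperner pair of families with $\mathcal{F},\mathcal{G} \subseteq 2^{[n]}$. Then $$|\mathcal{F}||\mathcal{G}| \le 2^{2n-4}.$$ This bound is best possible: the families $\mathcal{F}=\{F\in 2^{[n]} : 1 \in F,\ n \notin F\}$ and $\mathcal{G}=\{G\in 2^{[n]} : n \in G,\ 1 \notin G\}$ form a cross-Sperner pair with $|\mathcal{F}||\mathcal{G}| = 2^{2n-4}$.
   Context: $[n]=\{1,\dots,n\}$ and $2^{[n]}$ is its power set. A pair $(\mathcal{F},\mathcal{G})$ of families of sets is cross-Sperner if there exists no pair of sets $F \in \mathcal{F}$, $G \in \mathcal{G}$ with $F \subseteq G$ or $G \subseteq F$. -}

module Defs where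

open import Data.Fin using (Fin; zero; fromℕ)
open import Data.Fin.Subset using (Subset; inside; outside; _∈_; _∉_; _⊆_)
open import Data.Fin.Subset.Properties using (_∈?_)
open import Data.List using (List; []; _∷_; _++_; map; filter; length)
open import Data.Nat using (ℕ; zero; suc; _≤_; s≤s)
open import Data.Product using (∃₂; _×_)
open import Data.Sum using (_⊎_)
open import Data.Vec using ([]; _∷_)
open import Level using (0ℓ)
open import Relation.Nullary using (¬_; ¬?)
open import Relation.Nullary.Decidable using (_×-dec_)
open import Relation.Unary using (Pred; Decidable)

-- The ground set [n] = {1, …, n} is Fin n, so that the element k of [n] is the
-- element of Fin n with toℕ equal to k - 1.

-- Membership is required to be decidable so that a family has a cardinality.
record Family (n : ℕ) : Set₁ where
  field
    Member  : Pred (Subset n) 0ℓ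
    member? : Decidable Member

open Family public

infix 4 _∈ᶠ_

_∈ᶠ_ : ∀ {n} → Subset n → Family n → Set
A ∈ᶠ F = Member F A

-- Every subset occurs exactly once in this list.
allSubsets : ∀ n → List (Subset n)
allSubsets zero    = [] ∷ []
allSubsets (suc n) = map (outside ∷_) (allSubsets n) ++ map (inside ∷_) (allSubsets n)

∣_∣ᶠ : ∀ {n} → Family n → ℕ
∣_∣ᶠ {n} F = length (filter (member? F) (allSubsets n))

CrossSperner : ∀ {n} → Family n → Family n → Set
CrossSperner F G = ¬ ∃₂ λ A B → A ∈ᶠ F × B ∈ᶠ G × (A ⊆ B ⊎ B ⊆ A)

-- The elements 1 and n of [n].
first last : ∀ {n} → 2 ≤ n → Fin n
first (s≤s _)         = zero
last  (s≤s {n = m} _) = fromℕ m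

containing_avoiding_ : ∀ {n} → Fin n → Fin n → Family n
containing i avoiding j = record
  { Member  = λ A → i ∈ A × j ∉ A
  ; member? = λ A → (i ∈? A) ×-dec ¬? (j ∈? A)
  }

{-# OPTIONS --safe #-}

-- Let U be the family of sets containing both a member of F and a member of G,
-- and L the family of sets contained in both.  Since A ∪ B ∈ U and A ∩ B ∈ L for
-- A ∈ F and B ∈ G, the four functions theorem of Ahlswede and Daykin gives
-- |F||G| ≤ |U||L|.  The cross-Sperner property makes F, G, U and L pairwise
-- disjoint, so |F| + |G| + |U| + |L| ≤ 2ⁿ.  Hence |F| + |G| or |U| + |L| is at most
-- 2ⁿ⁻¹, and AM-GM bounds the corresponding product by (2ⁿ⁻²)².
module Submission where

open import Defs
open import Data.Bool using (Bool; false; true; _∧_; _∨_; if_then_else_)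
open import Data.Bool.Properties using (∧-identityʳ; ∧-zeroʳ)
open import Data.Fin using (Fin; zero; suc; fromℕ)
open import Data.Fin.Subset using (Subset; inside; outside; _⊆_; _∪_; _∩_)
open import Data.Fin.Subset.Properties using
  (_∈?_; _⊆?_; anySubset?; ⊆-refl; ⊆-trans; p⊆p∪q; q⊆p∪q; p∩q⊆p; p∩q⊆q)
open import Data.List using (List; []; _∷_; _++_; map; filter; length)
open import Data.List.Properties using (map-++; map-∘)
open import Data.Nat using (ℕ; zero; suc; _≤_; z≤n; s≤s; _+_; _*_; _^_; _∸_)
open import Data.Nat.ListAction using (sum)
open import Data.Nat.ListAction.Properties using (sum-++)
open import Data.Nat.Properties
open import Data.Nat.Tactic.RingSolver using (solve-∀)
open import Data.Product using (∃; _×_; _,_; proj₁; proj₂)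
open import Data.Sum using (_⊎_; inj₁; inj₂)
open import Data.Vec using ([]; _∷_)
open import Function using (_∘_)
open import Level using (0ℓ)
open import Relation.Binary.PropositionalEquality
  using (_≡_; refl; sym; trans; cong; cong₂; subst; _≗_; module ≡-Reasoning)
open import Relation.Nullary using (¬_; Dec; yes; no; does; ¬?; contradiction)
open import Relation.Nullary.Decidable using (_×-dec_; _⊎-dec_)
open import Relation.Unary using (Pred; Decidable)

private variable
  n : ℕ
  P Q R S : Set

-- Sums over the power set and indicator functions.

-- Recursion on the first element, rather than summation over the list `allSubsets`, makes the split
-- into sets without and with that element hold by definition.
∑ : (Subset n → ℕ) → ℕ
∑ {zero}  f = f []
∑ {suc n} f = ∑ (f ∘ (outside ∷_)) + ∑ (f ∘ (inside ∷_))

∑-cong : {f g : Subset n → ℕ} → f ≗ g → ∑ f ≡ ∑ g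
∑-cong {zero}  f≗g = f≗g []
∑-cong {suc n} f≗g = cong₂ _+_ (∑-cong (f≗g ∘ (outside ∷_))) (∑-cong (f≗g ∘ (inside ∷_)))

∑-mono : {f g : Subset n → ℕ} → (∀ A → f A ≤ g A) → ∑ f ≤ ∑ g
∑-mono {zero}  f≤g = f≤g []
∑-mono {suc n} f≤g = +-mono-≤ (∑-mono (f≤g ∘ (outside ∷_))) (∑-mono (f≤g ∘ (inside ∷_)))

+-interchange : ∀ a b c d → (a + b) + (c + d) ≡ (a + c) + (b + d)
+-interchange = solve-∀

∑-+ : (f g : Subset n → ℕ) → ∑ (λ A → f A + g A) ≡ ∑ f + ∑ g
∑-+ {zero}  f g = refl
∑-+ {suc n} f g = trans
  (cong₂ _+_ (∑-+ (f ∘ (outside ∷_)) (g ∘ (outside ∷_))) (∑-+ (f ∘ (inside ∷_)) (g ∘ (inside ∷_))))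
  (+-interchange (∑ (f ∘ (outside ∷_))) (∑ (g ∘ (outside ∷_))) _ _)

∑-const : ∀ n c → ∑ {n} (λ _ → c) ≡ 2 ^ n * c
∑-const zero    c = sym (*-identityˡ c)
∑-const (suc n) c rewrite ∑-const n c = double (2 ^ n) c
  where
  double : ∀ x c → x * c + x * c ≡ 2 * x * c
  double = solve-∀

sum-allSubsets : (f : Subset n → ℕ) → sum (map f (allSubsets n)) ≡ ∑ f
sum-allSubsets {zero}  f = +-identityʳ (f [])
sum-allSubsets {suc n} f = begin
  sum (map f (outs ++ ins))           ≡⟨ cong sum (map-++ f outs ins) ⟩
  sum (map f outs ++ map f ins)       ≡⟨ sum-++ (map f outs) (map f ins) ⟩
  sum (map f outs) + sum (map f ins)  ≡⟨ cong₂ _+_ (half outside) (half inside) ⟩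
  ∑ f                                 ∎
  where
  open ≡-Reasoning
  outs = map (outside ∷_) (allSubsets n)
  ins  = map (inside ∷_) (allSubsets n)
  half : ∀ s → sum (map f (map (s ∷_) (allSubsets n))) ≡ ∑ (f ∘ (s ∷_))
  half s = trans (cong sum (sym (map-∘ (allSubsets n)))) (sum-allSubsets (f ∘ (s ∷_)))

-- Only the Boolean `does` is inspected, so indicators of compound decisions simplify by
-- computation.
𝟙 : Dec P → ℕ
𝟙 P? = if does P? then 1 else 0

𝟙≤1 : (P? : Dec P) → 𝟙 P? ≤ 1
𝟙≤1 (yes _) = ≤-refl
𝟙≤1 (no _)  = z≤n

𝟙-⊎ : (P? : Dec P) (Q? : Dec Q) → ¬ (P × Q) → 𝟙 P? + 𝟙 Q? ≡ 𝟙 (P? ⊎-dec Q?)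
𝟙-⊎ (yes p) (yes q) ¬pq = contradiction (p , q) ¬pq
𝟙-⊎ (yes _) (no _)  _   = refl
𝟙-⊎ (no _)  _       _   = refl

-- Turns an implication between memberships into the pointwise hypothesis of `four-functions`.
𝟙-*-mono : (P? : Dec P) (Q? : Dec Q) (R? : Dec R) (S? : Dec S) →
           (P → Q → R × S) → 𝟙 P? * 𝟙 Q? ≤ 𝟙 R? * 𝟙 S?
𝟙-*-mono (no _)  _       _       _       _ = z≤n
𝟙-*-mono (yes _) (no _)  _       _       _ = z≤n
𝟙-*-mono (yes _) (yes _) (yes _) (yes _) _ = ≤-refl
𝟙-*-mono (yes p) (yes q) (no ¬r) _       h = contradiction (proj₁ (h p q)) ¬r
𝟙-*-mono (yes p) (yes q) (yes _) (no ¬s) h = contradiction (proj₂ (h p q)) ¬s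

length-filter-sum : {A : Set} {P : Pred A 0ℓ} (P? : Decidable P) (xs : List A) →
                    length (filter P? xs) ≡ sum (map (𝟙 ∘ P?) xs)
length-filter-sum P? []       = refl
length-filter-sum P? (x ∷ xs) with P? x
... | yes _ = cong suc (length-filter-sum P? xs)
... | no _  = length-filter-sum P? xs

∣∣ᶠ≡∑ : (F : Family n) → ∣ F ∣ᶠ ≡ ∑ (𝟙 ∘ member? F)
∣∣ᶠ≡∑ {n} F = trans (length-filter-sum (member? F) (allSubsets n)) (sum-allSubsets (𝟙 ∘ member? F))

-- The four functions theorem.

-- With z = v + y, multiplying the claim by z turns it into x y + x v ≤ z w + z v.
x+y≤z+w : ∀ {x y z w} → x ≤ z → y ≤ z → x * y ≤ z * w → x + y ≤ z + w
x+y≤z+w {z = zero} z≤n z≤n _ = z≤n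
x+y≤z+w {x} {y} {z@(suc _)} {w} x≤z y≤z xy≤zw = begin
  x + y        ≤⟨ +-monoˡ-≤ y (*-cancelˡ-≤ z zx≤z[w+v]) ⟩
  w + v + y    ≡⟨ rearrange w v y ⟩
  v + y + w    ≡⟨ cong (_+ w) v+y≡z ⟩
  z + w        ∎
  where
  open ≤-Reasoning
  v = z ∸ y
  v+y≡z : v + y ≡ z
  v+y≡z = m∸n+n≡m y≤z
  rearrange : ∀ w v y → w + v + y ≡ v + y + w
  rearrange = solve-∀
  expand : ∀ x y v → (v + y) * x ≡ x * y + x * v
  expand = solve-∀
  zx≤z[w+v] : z * x ≤ z * (w + v)
  zx≤z[w+v] = begin
    z * x          ≡⟨ cong (_* x) v+y≡z ⟨
    (v + y) * x    ≡⟨ expand x y v ⟩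
    x * y + x * v  ≤⟨ +-mono-≤ xy≤zw (*-monoˡ-≤ v x≤z) ⟩
    z * w + z * v  ≡⟨ *-distribˡ-+ z w v ⟨
    z * (w + v)    ∎

-- The case of a one-element ground set. Both mixed products `a₀ * b₁` and `a₁ * b₀` are at most
-- `c₁ * d₀`, and the two unmixed hypotheses bound their product by `(c₁ * d₀) * (c₀ * d₁)`, which
-- is what `x+y≤z+w` needs.
four-values : (a b c d : Bool → ℕ) → (∀ s t → a s * b t ≤ c (s ∨ t) * d (s ∧ t)) →
              (a false + a true) * (b false + b true) ≤ (c false + c true) * (d false + d true)
four-values a b c d h = begin
  (a₀ + a₁) * (b₀ + b₁)                      ≡⟨ expandˡ a₀ a₁ b₀ b₁ ⟩
  (a₀ * b₁ + a₁ * b₀) + (a₀ * b₀ + a₁ * b₁)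
    ≤⟨ +-mono-≤ (x+y≤z+w (h false true) (h true false) cross) (+-mono-≤ (h false false) (h true true)) ⟩
  (c₁ * d₀ + c₀ * d₁) + (c₀ * d₀ + c₁ * d₁)  ≡⟨ expandʳ c₀ c₁ d₀ d₁ ⟨
  (c₀ + c₁) * (d₀ + d₁)                      ∎
  where
  open ≤-Reasoning
  a₀ = a false; a₁ = a true
  b₀ = b false; b₁ = b true
  c₀ = c false; c₁ = c true
  d₀ = d false; d₁ = d true
  expandˡ : ∀ a₀ a₁ b₀ b₁ → (a₀ + a₁) * (b₀ + b₁) ≡ (a₀ * b₁ + a₁ * b₀) + (a₀ * b₀ + a₁ * b₁)
  expandˡ = solve-∀
  expandʳ : ∀ c₀ c₁ d₀ d₁ → (c₀ + c₁) * (d₀ + d₁) ≡ (c₁ * d₀ + c₀ * d₁) + (c₀ * d₀ + c₁ * d₁)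
  expandʳ = solve-∀
  swapˡ : ∀ a₀ a₁ b₀ b₁ → (a₀ * b₁) * (a₁ * b₀) ≡ (a₀ * b₀) * (a₁ * b₁)
  swapˡ = solve-∀
  swapʳ : ∀ c₀ c₁ d₀ d₁ → (c₀ * d₀) * (c₁ * d₁) ≡ (c₁ * d₀) * (c₀ * d₁)
  swapʳ = solve-∀
  cross : (a₀ * b₁) * (a₁ * b₀) ≤ (c₁ * d₀) * (c₀ * d₁)
  cross = begin
    (a₀ * b₁) * (a₁ * b₀)  ≡⟨ swapˡ a₀ a₁ b₀ b₁ ⟩
    (a₀ * b₀) * (a₁ * b₁)  ≤⟨ *-mono-≤ (h false false) (h true true) ⟩
    (c₀ * d₀) * (c₁ * d₁)  ≡⟨ swapʳ c₀ c₁ d₀ d₁ ⟩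
    (c₁ * d₀) * (c₀ * d₁)  ∎

-- Induction on the ground set: summing out the first element with `merge` leaves every total
-- unchanged, and the merged functions satisfy the hypothesis again by `four-values`.
four-functions : (a b c d : Subset n → ℕ) → (∀ A B → a A * b B ≤ c (A ∪ B) * d (A ∩ B)) →
                 ∑ a * ∑ b ≤ ∑ c * ∑ d
four-functions {zero}  a b c d h = h [] []
four-functions {suc n} a b c d h = begin
  ∑ a * ∑ b                  ≡⟨ cong₂ _*_ (∑-merge a) (∑-merge b) ⟨
  ∑ (merge a) * ∑ (merge b)  ≤⟨ four-functions (merge a) (merge b) (merge c) (merge d) merged ⟩
  ∑ (merge c) * ∑ (merge d)  ≡⟨ cong₂ _*_ (∑-merge c) (∑-merge d) ⟩
  ∑ c * ∑ d                  ∎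
  where
  open ≤-Reasoning
  merge : (Subset (suc n) → ℕ) → Subset n → ℕ
  merge f A = f (outside ∷ A) + f (inside ∷ A)
  ∑-merge : ∀ f → ∑ (merge f) ≡ ∑ f
  ∑-merge f = ∑-+ (f ∘ (outside ∷_)) (f ∘ (inside ∷_))
  merged : ∀ A B → merge a A * merge b B ≤ merge c (A ∪ B) * merge d (A ∩ B)
  -- With `A` and `B` fixed only the first coordinates vary, and on these union and intersection act
  -- as `_∨_` and `_∧_`.
  merged A B = four-values (λ s → a (s ∷ A)) (λ s → b (s ∷ B)) (λ s → c (s ∷ A ∪ B)) (λ s → d (s ∷ A ∩ B))
    (λ s t → h (s ∷ A) (t ∷ B))

-- Common upper and lower bounds of two families.

-- Upward and downward closure. The families U and L are `↑ F ∩ᶠ ↑ G` and `↓ F ∩ᶠ ↓ G`.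
↑_ ↓_ : Family n → Family n
↑ F = record
  { Member  = λ S → ∃ λ A → A ∈ᶠ F × A ⊆ S
  ; member? = λ S → anySubset? (λ A → member? F A ×-dec (A ⊆? S))
  }
↓ F = record
  { Member  = λ S → ∃ λ A → A ∈ᶠ F × S ⊆ A
  ; member? = λ S → anySubset? (λ A → member? F A ×-dec (S ⊆? A))
  }

infixr 7 _∩ᶠ_
infixr 6 _∪ᶠ_

_∩ᶠ_ _∪ᶠ_ : Family n → Family n → Family n
F ∩ᶠ G = record
  { Member  = λ S → S ∈ᶠ F × S ∈ᶠ G
  ; member? = λ S → member? F S ×-dec member? G S
  }
F ∪ᶠ G = record
  { Member  = λ S → S ∈ᶠ F ⊎ S ∈ᶠ G
  ; member? = λ S → member? F S ⊎-dec member? G S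
  }

Disjoint : Family n → Family n → Set
Disjoint F G = ∀ S → ¬ (S ∈ᶠ F × S ∈ᶠ G)

∣∪ᶠ∣ : (F G : Family n) → Disjoint F G → ∣ F ∣ᶠ + ∣ G ∣ᶠ ≡ ∣ F ∪ᶠ G ∣ᶠ
∣∪ᶠ∣ F G F#G = begin
  ∣ F ∣ᶠ + ∣ G ∣ᶠ                        ≡⟨ cong₂ _+_ (∣∣ᶠ≡∑ F) (∣∣ᶠ≡∑ G) ⟩
  ∑ (𝟙 ∘ member? F) + ∑ (𝟙 ∘ member? G)  ≡⟨ ∑-+ (𝟙 ∘ member? F) (𝟙 ∘ member? G) ⟨
  ∑ (λ S → 𝟙 (member? F S) + 𝟙 (member? G S))
    ≡⟨ ∑-cong (λ S → 𝟙-⊎ (member? F S) (member? G S) (F#G S)) ⟩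
  ∑ (𝟙 ∘ member? (F ∪ᶠ G))               ≡⟨ ∣∣ᶠ≡∑ (F ∪ᶠ G) ⟨
  ∣ F ∪ᶠ G ∣ᶠ                            ∎
  where open ≡-Reasoning

∣∣ᶠ≤2^n : (F : Family n) → ∣ F ∣ᶠ ≤ 2 ^ n
∣∣ᶠ≤2^n {n} F = begin
  ∣ F ∣ᶠ               ≡⟨ ∣∣ᶠ≡∑ F ⟩
  ∑ (𝟙 ∘ member? F)    ≤⟨ ∑-mono (λ S → 𝟙≤1 (member? F S)) ⟩
  ∑ {n} (λ _ → 1)      ≡⟨ ∑-const n 1 ⟩
  2 ^ n * 1            ≡⟨ *-identityʳ (2 ^ n) ⟩
  2 ^ n                ∎
  where open ≤-Reasoning

-- The four functions theorem for indicators: `A` and `B` themselves witness that `A ∪ B` and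
-- `A ∩ B` are common bounds.
∣F∣*∣G∣≤∣bounds∣ : (F G : Family n) → ∣ F ∣ᶠ * ∣ G ∣ᶠ ≤ ∣ ↑ F ∩ᶠ ↑ G ∣ᶠ * ∣ ↓ F ∩ᶠ ↓ G ∣ᶠ
∣F∣*∣G∣≤∣bounds∣ F G
  rewrite ∣∣ᶠ≡∑ F | ∣∣ᶠ≡∑ G | ∣∣ᶠ≡∑ (↑ F ∩ᶠ ↑ G) | ∣∣ᶠ≡∑ (↓ F ∩ᶠ ↓ G) =
  four-functions (𝟙 ∘ member? F) (𝟙 ∘ member? G) (𝟙 ∘ member? (↑ F ∩ᶠ ↑ G)) (𝟙 ∘ member? (↓ F ∩ᶠ ↓ G))
    (λ A B → 𝟙-*-mono (member? F A) (member? G B) (member? (↑ F ∩ᶠ ↑ G) (A ∪ B)) (member? (↓ F ∩ᶠ ↓ G) (A ∩ B))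
      (λ A∈F B∈G → ((A , A∈F , p⊆p∪q B) , (B , B∈G , q⊆p∪q A B))
                 , ((A , A∈F , p∩q⊆p A B) , (B , B∈G , p∩q⊆q A B))))

-- A set `S` in two of the four families would yield a comparable pair: `S` is one of its members
-- or, if `S` lies in `U` and `L`, sits between a member of `F` and a member of `G`.
∣F∣+∣G∣+∣bounds∣≤2^n : (F G : Family n) → CrossSperner F G →
  (∣ F ∣ᶠ + ∣ G ∣ᶠ) + (∣ ↑ F ∩ᶠ ↑ G ∣ᶠ + ∣ ↓ F ∩ᶠ ↓ G ∣ᶠ) ≤ 2 ^ n
∣F∣+∣G∣+∣bounds∣≤2^n {n} F G F⊥G = begin
  (∣ F ∣ᶠ + ∣ G ∣ᶠ) + (∣ U ∣ᶠ + ∣ L ∣ᶠ)  ≡⟨ cong₂ _+_ (∣∪ᶠ∣ F G F#G) (∣∪ᶠ∣ U L U#L) ⟩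
  ∣ F ∪ᶠ G ∣ᶠ + ∣ U ∪ᶠ L ∣ᶠ              ≡⟨ ∣∪ᶠ∣ (F ∪ᶠ G) (U ∪ᶠ L) FG#UL ⟩
  ∣ (F ∪ᶠ G) ∪ᶠ (U ∪ᶠ L) ∣ᶠ              ≤⟨ ∣∣ᶠ≤2^n ((F ∪ᶠ G) ∪ᶠ (U ∪ᶠ L)) ⟩
  2 ^ n                                  ∎
  where
  open ≤-Reasoning
  U = ↑ F ∩ᶠ ↑ G
  L = ↓ F ∩ᶠ ↓ G
  F#G : Disjoint F G
  F#G S (S∈F , S∈G) = F⊥G (S , S , S∈F , S∈G , inj₁ ⊆-refl)
  U#L : Disjoint U L
  U#L S (((A , A∈F , A⊆S) , _) , (_ , (B , B∈G , S⊆B))) =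
    F⊥G (A , B , A∈F , B∈G , inj₁ (⊆-trans A⊆S S⊆B))
  FG#UL : Disjoint (F ∪ᶠ G) (U ∪ᶠ L)
  FG#UL S (inj₁ S∈F , inj₁ (_ , (B , B∈G , B⊆S))) = F⊥G (S , B , S∈F , B∈G , inj₂ B⊆S)
  FG#UL S (inj₁ S∈F , inj₂ (_ , (B , B∈G , S⊆B))) = F⊥G (S , B , S∈F , B∈G , inj₁ S⊆B)
  FG#UL S (inj₂ S∈G , inj₁ ((A , A∈F , A⊆S) , _)) = F⊥G (A , S , A∈F , S∈G , inj₁ A⊆S)
  FG#UL S (inj₂ S∈G , inj₂ ((A , A∈F , S⊆A) , _)) = F⊥G (A , S , A∈F , S∈G , inj₂ S⊆A)

-- Arithmetic of the upper bound.

-- If p ≤ m and u = m ∸ p, then q ≤ p + 2 u and p (p + 2 u) ≤ (p + u)².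
am-gm-≤ : ∀ {p q m} → p ≤ m → p + q ≤ m + m → p * q ≤ m * m
am-gm-≤ {p} {q} {m} p≤m p+q≤2m with u , refl ← m≤n⇒∃[o]m+o≡n p≤m = begin
  p * q                      ≤⟨ *-monoʳ-≤ p (+-cancelˡ-≤ p _ _ (≤-trans p+q≤2m (≤-reflexive (regroup p u)))) ⟩
  p * (p + u + u)            ≤⟨ m≤m+n _ (u * u) ⟩
  p * (p + u + u) + u * u    ≡⟨ complete-square p u ⟩
  (p + u) * (p + u)          ∎
  where
  open ≤-Reasoning
  regroup : ∀ p u → (p + u) + (p + u) ≡ p + (p + u + u)
  regroup = solve-∀
  complete-square : ∀ p u → p * (p + u + u) + u * u ≡ (p + u) * (p + u)
  complete-square = solve-∀

-- If `p` is at least `m`, then `q` is at most `m`, and the factors can be swapped.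
am-gm : ∀ p q m → p + q ≤ m + m → p * q ≤ m * m
am-gm p q m p+q≤2m with ≤-total p m
... | inj₁ p≤m = am-gm-≤ p≤m p+q≤2m
... | inj₂ m≤p = subst (_≤ m * m) (*-comm q p) (am-gm-≤ q≤m (subst (_≤ m + m) (+-comm p q) p+q≤2m))
  where q≤m = +-cancelˡ-≤ m q m (≤-trans (+-monoˡ-≤ q m≤p) p+q≤2m)

sum-of-two≤half : ∀ {x y} m → x + y ≤ m + m → x ≤ m ⊎ y ≤ m
sum-of-two≤half {x} {y} m x+y≤2m with ≤-total x m
... | inj₁ x≤m = inj₁ x≤m
... | inj₂ m≤x = inj₂ (+-cancelˡ-≤ m y m (≤-trans (+-monoˡ-≤ y m≤x) x+y≤2m))

-- Here `m` is a quarter of the size of the power set, which avoids division.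
product-bound : ∀ p q r s m → p * q ≤ r * s → (p + q) + (r + s) ≤ (m + m) + (m + m) → p * q ≤ m * m
product-bound p q r s m pq≤rs total with sum-of-two≤half (m + m) total
... | inj₁ p+q≤2m = am-gm p q m p+q≤2m
... | inj₂ r+s≤2m = ≤-trans pq≤rs (am-gm r s m r+s≤2m)

2^[2+k]≡4*2^k : ∀ k → 2 ^ (2 + k) ≡ (2 ^ k + 2 ^ k) + (2 ^ k + 2 ^ k)
2^[2+k]≡4*2^k k = quadruple (2 ^ k)
  where
  quadruple : ∀ x → 2 * (2 * x) ≡ (x + x) + (x + x)
  quadruple = solve-∀

2^k*2^k≡2^[2*[2+k]∸4] : ∀ k → 2 ^ k * 2 ^ k ≡ 2 ^ (2 * (2 + k) ∸ 4)
2^k*2^k≡2^[2*[2+k]∸4] k = begin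
  2 ^ k * 2 ^ k            ≡⟨ ^-distribˡ-+-* 2 k k ⟨
  -- `4 + (k + k) ∸ 4` computes to `k + k`, so the truncated subtraction loses nothing.
  2 ^ (k + k)              ≡⟨ cong (λ e → 2 ^ (e ∸ 4)) (shift k) ⟩
  2 ^ (2 * (2 + k) ∸ 4)    ∎
  where
  open ≡-Reasoning
  shift : ∀ k → 4 + (k + k) ≡ 2 * (2 + k)
  shift = solve-∀

-- The extremal pair.

-- The element `i` rules out `A ⊆ B`, and `j` rules out `B ⊆ A`.
containing-avoiding-crossSperner : (i j : Fin n) → CrossSperner (containing i avoiding j) (containing j avoiding i)
containing-avoiding-crossSperner i j (A , B , (i∈A , _) , (_ , i∉B) , inj₁ A⊆B) = i∉B (A⊆B i∈A)
containing-avoiding-crossSperner i j (A , B , (_ , j∉A) , (j∈B , _) , inj₂ B⊆A) = j∉A (B⊆A j∈B)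

2^n+2^n≡2^[1+n] : ∀ n → 2 ^ n + 2 ^ n ≡ 2 ^ suc n
2^n+2^n≡2^[1+n] n = cong (2 ^ n +_) (sym (+-identityʳ (2 ^ n)))

∑-∈ : ∀ {n} (i : Fin (suc n)) → ∑ (λ A → 𝟙 (i ∈? A)) ≡ 2 ^ n
∑-∈ {n} zero = trans (cong₂ _+_ (∑-const n 0) (∑-const n 1)) (0+1 (2 ^ n))
  where
  0+1 : ∀ x → x * 0 + x * 1 ≡ x
  0+1 = solve-∀
∑-∈ {suc n} (suc i) = trans (cong₂ _+_ (∑-∈ i) (∑-∈ i)) (2^n+2^n≡2^[1+n] n)

∑-∉ : ∀ {n} (i : Fin (suc n)) → ∑ (λ A → 𝟙 (¬? (i ∈? A))) ≡ 2 ^ n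
∑-∉ {n} zero = trans (cong₂ _+_ (∑-const n 1) (∑-const n 0)) (1+0 (2 ^ n))
  where
  1+0 : ∀ x → x * 1 + x * 0 ≡ x
  1+0 = solve-∀
∑-∉ {suc n} (suc i) = trans (cong₂ _+_ (∑-∉ i) (∑-∉ i)) (2^n+2^n≡2^[1+n] n)

∑-0 : ∀ n → ∑ {n} (λ _ → 0) ≡ 0
∑-0 n = trans (∑-const n 0) (*-zeroʳ (2 ^ n))

-- Sets without `zero` contribute 0; on the others the indicator computes to that of avoiding `i`.
∣containing-zero-avoiding-suc∣ : ∀ {k} (i : Fin (suc k)) → ∣ containing zero avoiding suc i ∣ᶠ ≡ 2 ^ k
∣containing-zero-avoiding-suc∣ {k} i =
  trans (∣∣ᶠ≡∑ (containing zero avoiding suc i)) (cong₂ _+_ (∑-0 (suc k)) (∑-∉ i))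

∣containing-suc-avoiding-zero∣ : ∀ {k} (i : Fin (suc k)) → ∣ containing suc i avoiding zero ∣ᶠ ≡ 2 ^ k
∣containing-suc-avoiding-zero∣ {k} i = begin
  ∣ containing suc i avoiding zero ∣ᶠ                     ≡⟨ ∣∣ᶠ≡∑ (containing suc i avoiding zero) ⟩
  ∑ (𝟙 ∘ member? (containing suc i avoiding zero))
    -- The conjunct about `zero` now comes second, where `_∧_` does not compute, so it is removed by
    -- rewriting.
    ≡⟨ cong₂ _+_ (∑-cong (λ A → cong 𝟙ᵇ (∧-identityʳ (does (i ∈? A)))))
                 (∑-cong (λ A → cong 𝟙ᵇ (∧-zeroʳ (does (i ∈? A))))) ⟩
  ∑ (λ A → 𝟙 (i ∈? A)) + ∑ {suc k} (λ _ → 0)              ≡⟨ cong₂ _+_ (∑-∈ i) (∑-0 (suc k)) ⟩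
  2 ^ k + 0                                               ≡⟨ +-identityʳ (2 ^ k) ⟩
  2 ^ k                                                   ∎
  where
  open ≡-Reasoning
  𝟙ᵇ : Bool → ℕ
  𝟙ᵇ b = if b then 1 else 0

theorem1p2 : (n : ℕ) (2≤n : 2 ≤ n) →
    ((F G : Family n) → CrossSperner F G → ∣ F ∣ᶠ * ∣ G ∣ᶠ ≤ 2 ^ (2 * n ∸ 4))
    × (CrossSperner (containing first 2≤n avoiding last 2≤n) (containing last 2≤n avoiding first 2≤n)
    × ∣ containing first 2≤n avoiding last 2≤n ∣ᶠ * ∣ containing last 2≤n avoiding first 2≤n ∣ᶠ ≡ 2 ^ (2 * n ∸ 4))
-- Matching on `2≤n` lets `first` and `last` compute to `zero` and `suc (fromℕ k)`.
theorem1p2 (suc (suc k)) 2≤n@(s≤s (s≤s z≤n)) =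
    (λ F G F⊥G → ≤-trans
      (product-bound ∣ F ∣ᶠ ∣ G ∣ᶠ ∣ ↑ F ∩ᶠ ↑ G ∣ᶠ ∣ ↓ F ∩ᶠ ↓ G ∣ᶠ (2 ^ k) (∣F∣*∣G∣≤∣bounds∣ F G)
        (≤-trans (∣F∣+∣G∣+∣bounds∣≤2^n F G F⊥G) (≤-reflexive (2^[2+k]≡4*2^k k))))
      (≤-reflexive (2^k*2^k≡2^[2*[2+k]∸4] k)))
  , containing-avoiding-crossSperner (first 2≤n) (last 2≤n)
  , trans (cong₂ _*_ (∣containing-zero-avoiding-suc∣ (fromℕ k)) (∣containing-suc-avoiding-zero∣ (fromℕ k)))
          (2^k*2^k≡2^[2*[2+k]∸4] k)
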